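{- Let $G$ be a graph with graphical building set $\mathcal{B}(G)$. The acyclic orientations of $\mathcal{B}(G)$ are in one-to-one correspondence with the elimination forests of $G$, and the flip graph on the acyclic orientations of $\mathcal{B}(G)$ is isomorphic to the rotation graph on the elimination forests of $G$.
   Context: Graphs are finite and simple. For $G=(V,E)$, the graphical building set $\mathcal{B}(G)=(V,\mathcal{E})$ is the hypergraph with $\mathcal{E}=\{U\subseteq V\mid U\neq\emptyset,\ G[U]\text{ is connected}\}$. An orientation of a hypergraph $(V,\mathcal{E})$ is a map $h:\mathcal{E}\to V$ with $h(A)\in A$ for all $A\in\mathcal{E}$. It is acyclic if the digraph on $V$ with an arc $i\to j$ for all distinct $i,j$ such that $i,j\in A$ and $j=h(A)$ for some $A\in\mathcal{E}$ is acyclic. A pair flip of a pair $(i,j)$ of distinct vertices maps $h$ to the orientation $h'$ with $h'(A)=i$ if $h(A)=j$ and $i\in A$, and $h'(A)=h(A)$ otherwise, where $h'\ne h$ is required. The flip graph on acyclic orientations joins two acyclic orientations iff they differ in a pair flip. An elimination tree of a connected graph $G$ is an unordered rooted tree obtained by removing a vertex $v$ of $G$, which becomes the root, and recursing on the connected components of $G-v$, whose elimination trees become the subtrees of $v$. An elimination forest of a graph is a set of elimination trees, one for each connected component. With $V=[n]$, a permutation of $[n]$ produces an elimination forest by always removing, from each component, the vertex that appears leftmost in the permutation. Two distinct elimination forests differ by a rotation if there exist two permutations producing them that differ by a single adjacent transposition. The rotation graph has the elimination forests of $G$ as vertices and an edge between any two that differ by a rotation. -}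

module Defs where

open import Data.Fin using (Fin; toℕ; _≤_)
open import Data.Fin.Permutation as Perm
  using (Permutation′; _⟨$⟩ʳ_; _⟨$⟩ˡ_; _∘ₚ_; transpose)
open import Data.Fin.Subset using (Subset; _∈_; _⊆_; _-_; ⊤; Nonempty)
open import Data.Nat using (ℕ; suc)
open import Data.Product using (Σ-syntax; ∃-syntax; _×_; proj₁)
open import Data.Refinement using (Refinement; value)
open import Level using (0ℓ)
open import Relation.Binary.Bundles using (Setoid)
open import Relation.Binary.Construct.Closure.ReflexiveTransitive using (Star)
open import Relation.Binary.Construct.Closure.Transitive using (TransClosure)
import Relation.Binary.Construct.On as On
open import Relation.Binary.Core using (Rel)
open import Relation.Binary.Definitions using (Decidable; Irreflexive; Symmetric)
open import Relation.Binary.PropositionalEquality using (_≡_; _≢_; refl; sym; trans)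
open import Relation.Nullary using (¬_)
open import Relation.Unary using (Pred)

record Graph (n : ℕ) : Set₁ where
  field
    Adj    : Rel (Fin n) 0ℓ
    adj?   : Decidable Adj
    symm   : Symmetric Adj
    irrefl : Irreflexive _≡_ Adj

open Graph public

InducedAdj : ∀ {n} → Graph n → Subset n → Rel (Fin n) 0ℓ
InducedAdj G U x y = x ∈ U × y ∈ U × Adj G x y

-- Holds vacuously for the empty set; nonemptiness is demanded separately in 𝓑.
Connected : ∀ {n} → Graph n → Subset n → Set
Connected G U = ∀ {x y} → x ∈ U → y ∈ U → Star (InducedAdj G U) x y

Hypergraph : ℕ → Set₁
Hypergraph n = Pred (Subset n) 0ℓ

-- The membership proof is irrelevant, so a hyperedge is determined by its
-- underlying set and functions on hyperedges cannot depend on the proof.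
Edge : ∀ {n} → Hypergraph n → Set
Edge {n} H = Refinement (Subset n) H

𝓑 : ∀ {n} → Graph n → Hypergraph n
𝓑 G U = Nonempty U × Connected G U

record Orientation {n} (H : Hypergraph n) : Set where
  field
    head   : Edge H → Fin n
    head∈  : ∀ A → head A ∈ value A

open Orientation public

module _ {n} {H : Hypergraph n} where

  infix 4 _≈ᵒ_
  _≈ᵒ_ : Rel (Orientation H) 0ℓ
  h ≈ᵒ h′ = ∀ A → head h A ≡ head h′ A

  Arc : Orientation H → Rel (Fin n) 0ℓ
  Arc h i j = i ≢ j × ∃[ A ] (i ∈ value A × j ∈ value A × j ≡ head h A)

  Acyclic : Orientation H → Set
  Acyclic h = ∀ {i} → ¬ TransClosure (Arc h) i i

  record PairFlip (i j : Fin n) (h h′ : Orientation H) : Set where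
    field
      distinct : i ≢ j
      flipped  : ∀ A → head h A ≡ j × i ∈ value A → head h′ A ≡ i
      kept     : ∀ A → ¬ (head h A ≡ j × i ∈ value A) → head h′ A ≡ head h A
      changed  : ¬ (h′ ≈ᵒ h)

AcyclicOrientation : ∀ {n} → Hypergraph n → Set
AcyclicOrientation H = Σ[ h ∈ Orientation H ] Acyclic h

acyclicOrientations : ∀ {n} → Hypergraph n → Setoid 0ℓ 0ℓ
acyclicOrientations H = On.setoid orientations (proj₁ {B = Acyclic {H = H}})
  where
  orientations : Setoid 0ℓ 0ℓ
  orientations = record
    { Carrier       = Orientation H
    ; _≈_           = _≈ᵒ_
    ; isEquivalence = record
      { refl  = λ A → refl
      ; sym   = λ p A → sym (p A)
      ; trans = λ p q A → trans (p A) (q A)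
      }
    }

FlipGraph : ∀ {n} (H : Hypergraph n) → Rel (AcyclicOrientation H) 0ℓ
FlipGraph H h h′ = ∃[ i ] ∃[ j ] PairFlip i j (proj₁ h) (proj₁ h′)

-- K is the vertex set of a connected component of the induced subgraph G[U]:
-- an inclusion-maximal nonempty connected subset of U.
IsComponent : ∀ {n} → Graph n → Subset n → Subset n → Set
IsComponent G U K =
  K ⊆ U × 𝓑 G K × (∀ L → L ⊆ U → 𝓑 G L → K ⊆ L → L ⊆ K)

Component : ∀ {n} → Graph n → Subset n → Set
Component {n} G U = Refinement (Subset n) (IsComponent G U)

-- Elimination trees of G[C], used only for connected C.  The subtrees of the
-- root are indexed by the components of G[C] - v, hence carry no order.
data ElimTree {n} (G : Graph n) (C : Subset n) : Set where
  node : (v : Fin n) → v ∈ C →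
         ((K : Component G (C - v)) → ElimTree G (value K)) →
         ElimTree G C

ElimForest : ∀ {n} → Graph n → Set
ElimForest G = (K : Component G ⊤) → ElimTree G (value K)

module _ {n} {G : Graph n} where

  -- Equality of labelled unordered rooted trees: equal roots and equal
  -- subtrees on every component.
  infix 4 _≈ᵗ_ _≈ᶠ_
  data _≈ᵗ_ {C : Subset n} : Rel (ElimTree G C) 0ℓ where
    node : ∀ {v} {v∈C v∈C′ : v ∈ C}
           {ts ts′ : (K : Component G (C - v)) → ElimTree G (value K)} →
           (∀ K → ts K ≈ᵗ ts′ K) → node v v∈C ts ≈ᵗ node v v∈C′ ts′

  _≈ᶠ_ : Rel (ElimForest G) 0ℓ
  F ≈ᶠ F′ = ∀ K → F K ≈ᵗ F′ K

  ≈ᵗ-refl : ∀ {C} (t : ElimTree G C) → t ≈ᵗ t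
  ≈ᵗ-refl (node v _ ts) = node (λ K → ≈ᵗ-refl (ts K))

  ≈ᵗ-sym : ∀ {C} {t t′ : ElimTree G C} → t ≈ᵗ t′ → t′ ≈ᵗ t
  ≈ᵗ-sym (node p) = node (λ K → ≈ᵗ-sym (p K))

  ≈ᵗ-trans : ∀ {C} {t t′ t″ : ElimTree G C} → t ≈ᵗ t′ → t′ ≈ᵗ t″ → t ≈ᵗ t″
  ≈ᵗ-trans (node p) (node q) = node (λ K → ≈ᵗ-trans (p K) (q K))

  -- A permutation π lists the vertices: π ⟨$⟩ʳ k is the k-th entry, and
  -- π ⟨$⟩ˡ v is the position of v.
  Leftmost : Permutation′ n → Subset n → Fin n → Set
  Leftmost π C v = ∀ {u} → u ∈ C → π ⟨$⟩ˡ v ≤ π ⟨$⟩ˡ u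

  data ProducesTree (π : Permutation′ n) {C : Subset n} : ElimTree G C → Set where
    node : ∀ {v} {v∈C : v ∈ C}
           {ts : (K : Component G (C - v)) → ElimTree G (value K)} →
           Leftmost π C v → (∀ K → ProducesTree π (ts K)) →
           ProducesTree π (node v v∈C ts)

  Produces : Permutation′ n → ElimForest G → Set
  Produces π F = ∀ K → ProducesTree π (F K)

-- σ is π with the entries at two consecutive positions exchanged.
AdjacentTransposition : ∀ {n} → Rel (Permutation′ n) 0ℓ
AdjacentTransposition π σ =
  ∃[ k ] ∃[ l ] (toℕ l ≡ suc (toℕ k) × σ Perm.≈ transpose k l ∘ₚ π)

eliminationForests : ∀ {n} → Graph n → Setoid 0ℓ 0ℓ
eliminationForests G = record
  { Carrier       = ElimForest G
  ; _≈_           = _≈ᶠ_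
  ; isEquivalence = record
    { refl  = λ {F} K → ≈ᵗ-refl (F K)
    ; sym   = λ p K → ≈ᵗ-sym (p K)
    ; trans = λ p q K → ≈ᵗ-trans (p K) (q K)
    }
  }

RotationGraph : ∀ {n} (G : Graph n) → Rel (ElimForest G) 0ℓ
RotationGraph G F F′ =
  ¬ (F ≈ᶠ F′) ×
  ∃[ π ] ∃[ σ ] (Produces π F × Produces σ F′ × AdjacentTransposition π σ)

-- The root of an elimination tree on C is the head of C, and an acyclic orientation is hereditary:
-- if A ⊆ C contains the head of C, this is also the head of A.  So the head of any edge A is found
-- by descending into the component that contains A until the root lies in A, and forests and acyclic
-- orientations determine each other; acyclicity holds because arcs decrease the depth.
--
-- A permutation produces the forest of h exactly if the head of every edge is its leftmost vertex,
-- so exchanging two neighbouring entries flips a pair.  Conversely, if flipping (i, j) keeps h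
-- acyclic, then i is a child of j in the forest of h, hence sorting the vertices by depth, with j
-- last and i first on their levels, makes them neighbours.
module Submission where

open import Defs
open import Data.Empty using (⊥-elim)
open import Data.Fin using (Fin; zero; suc; toℕ; fromℕ<; punchOut)
open import Data.Fin.Permutation as Perm
  using (Permutation′; permutation; transpose; _⟨$⟩ʳ_; _⟨$⟩ˡ_; _∘ₚ_; inverseˡ; inverseʳ)
import Data.Fin.Permutation.Components as PC
open import Data.Fin.Properties
  using (_≟_; any?; toℕ-injective; toℕ<n; toℕ-fromℕ<; punchOut-injective; <⇒notInjective)
open import Data.Fin.Subset
  using (Subset; _∈_; _∉_; _⊆_; _⊂_; _⊃_; _-_; _∪_; ⁅_⁆; ∣_∣; ⊤; Nonempty)
open import Data.Fin.Subset.Induction using (⊂-wellFounded; ⊃-wellFounded)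
open import Data.Fin.Subset.Properties
open import Data.Irrelevant using ([_])
open import Data.Nat using (ℕ; zero; suc; _+_; _*_; _<_; _≤_; s<s; z<s; s≤s; s≤s⁻¹)
import Data.Nat.Properties as ℕ
open import Data.Product using (Σ-syntax; ∃-syntax; _×_; _,_; proj₁; proj₂)
open import Data.Refinement using (value; _,_; value-injective)
open import Data.Sum using (inj₁; inj₂)
open import Data.Vec using (_∷_; there; tabulate)
open import Data.Vec.Properties using (lookup∘tabulate; lookup⇒[]=; []=⇒lookup)
open import Function using (_∘_)
open import Function.Bundles using (Inverse; _⇔_; mk⇔)
open import Function.Definitions using (Injective)
open import Induction.WellFounded using (Acc; acc)
open import Relation.Binary.Construct.Closure.ReflexiveTransitive
  using (Star; ε; _◅_; _◅◅_; return; reverse)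
import Relation.Binary.Construct.Closure.ReflexiveTransitive as Star
open import Relation.Binary.Construct.Closure.Transitive using (TransClosure; [_]; _∷_)
open import Relation.Binary.Definitions using (tri<; tri≈; tri>)
open import Relation.Binary.PropositionalEquality
  using (_≡_; _≢_; refl; sym; trans; cong; subst; subst₂; module ≡-Reasoning)
open import Relation.Nullary using (¬_; Dec; yes; no; contradiction; recompute)
open import Relation.Nullary.Decidable using (_×-dec_; ¬?; does; dec-true; dec-false)

-- Removal of a vertex from a subset, and heredity of heads.

x∉p-x : ∀ {n} (p : Subset n) x → x ∉ p - x
x∉p-x (_ ∷ p) zero    ()
x∉p-x (_ ∷ p) (suc x) (there x∈) = x∉p-x p x x∈

module _ {n} {p : Subset n} {x : Fin n} where

  ∈-minus⇒∈ : ∀ {y} → y ∈ p - x → y ∈ p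
  ∈-minus⇒∈ = p─q⊆p p ⁅ x ⁆

  ∈-minus⇒≢ : ∀ {y} → y ∈ p - x → y ≢ x
  ∈-minus⇒≢ y∈ refl = x∉p-x p x y∈

  ⊆-minus : ∀ {q} → q ⊆ p → x ∉ q → q ⊆ p - x
  ⊆-minus q⊆p x∉q y∈q = x∈p∧x≢y⇒x∈p-y (q⊆p y∈q) λ { refl → x∉q y∈q }

-- The consequence of acyclicity that recovers an orientation from its forest: a root fixes the head
-- of every edge of its tree that contains it.
Hereditary : ∀ {n} {H : Hypergraph n} → Orientation H → Set
Hereditary h = ∀ A C → value A ⊆ value C → head h C ∈ value A → head h A ≡ head h C

-- Were the heads of A and C distinct, they would form a 2-cycle of arcs.
acyclic⇒hereditary : ∀ {n} {H : Hypergraph n} (h : Orientation H) → Acyclic h → Hereditary h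
acyclic⇒hereditary h ac A C A⊆C hC∈A with head h A ≟ head h C
... | yes eq = eq
... | no neq = contradiction
  ((neq , C , A⊆C (head∈ h A) , head∈ h C , refl) ∷
   [ (neq ∘ sym) , A , hC∈A , head∈ h A , refl ]) ac

-- Permutations that sort by a rank.

injective⇒permutation : ∀ {n} (f : Fin n → Fin n) → Injective _≡_ _≡_ f →
                        Σ[ π ∈ Permutation′ n ] (∀ x → π ⟨$⟩ˡ x ≡ f x)
injective⇒permutation {n} f inj =
  permutation (λ y → proj₁ (preimage inj y)) f
    (λ x → inj (proj₂ (preimage inj (f x)))) (λ y → proj₂ (preimage inj y)) ,
  λ _ → refl
  where
  preimage : ∀ {m} {g : Fin m → Fin m} → Injective _≡_ _≡_ g → ∀ y → ∃[ x ] g x ≡ y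
  preimage {suc m} {g} inj y with any? (λ x → g x ≟ y)
  ... | yes x = x
  -- Pigeonhole: punching the missed value `y` out of the codomain would leave an injection into a
  -- smaller set.
  ... | no ∄x = ⊥-elim (<⇒notInjective {f = punchOut ∘ y≢} ℕ.≤-refl
                 (inj ∘ punchOut-injective (y≢ _) (y≢ _)))
    where
    y≢ : ∀ x → y ≢ g x
    y≢ x eq = ∄x (x , sym eq)

module _ {n} (rank : Fin n → ℕ) where

  private
    -- The vertex itself breaks ties.
    key : Fin n → ℕ
    key x = rank x * n + toℕ x

    key-mono : ∀ {x y} → rank x < rank y → key x < key y
    key-mono {x} {y} rx<ry = begin-strict
      rank x * n + toℕ x  <⟨ ℕ.+-monoʳ-< (rank x * n) (toℕ<n x) ⟩
      rank x * n + n      ≡⟨ ℕ.+-comm (rank x * n) n ⟩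
      suc (rank x) * n    ≤⟨ ℕ.*-monoˡ-≤ n rx<ry ⟩
      rank y * n          ≤⟨ ℕ.m≤m+n _ _ ⟩
      key y               ∎
      where open ℕ.≤-Reasoning

    key-injective : Injective _≡_ _≡_ key
    key-injective {x} {y} eq with ℕ.<-cmp (rank x) (rank y)
    ... | tri< lt _ _ = contradiction eq (ℕ.<⇒≢ (key-mono lt))
    ... | tri> _ _ gt = contradiction (sym eq) (ℕ.<⇒≢ (key-mono gt))
    ... | tri≈ _ rx≡ry _ = toℕ-injective (ℕ.+-cancelˡ-≡ (rank x * n) _ _
            (trans eq (cong (λ r → r * n + toℕ y) (sym rx≡ry))))

    below : Fin n → Subset n
    below x = tabulate λ y → does (key y ℕ.<? key x)

    ∈-below⁺ : ∀ {x y} → key y < key x → y ∈ below x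
    ∈-below⁺ {x} {y} lt = lookup⇒[]= y _
      (trans (lookup∘tabulate _ y) (dec-true (key y ℕ.<? key x) lt))

    ∈-below⁻ : ∀ {x y} → y ∈ below x → key y < key x
    ∈-below⁻ {x} {y} y∈ with key y ℕ.<? key x
    ... | yes lt = lt
    ... | no ≮   = contradiction
          (trans (sym (dec-false (key y ℕ.<? key x) ≮))
            (trans (sym (lookup∘tabulate _ y)) ([]=⇒lookup y∈)))
          λ ()

    x∉below : ∀ {x} → x ∉ below x
    x∉below = ℕ.<-irrefl refl ∘ ∈-below⁻

    below-mono : ∀ {x y} → key x < key y → ∣ below x ∣ < ∣ below y ∣
    below-mono lt = p⊂q⇒∣p∣<∣q∣
      ((λ z∈ → ∈-below⁺ (ℕ.<-trans (∈-below⁻ z∈) lt)) , _ , ∈-below⁺ lt , x∉below)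

    -- Counting the vertices of smaller key turns keys into positions; the count stays below `n`
    -- because `x` itself is not counted.
    position : Fin n → Fin n
    position x = fromℕ< (subst (∣ below x ∣ <_) (∣⊤∣≡n n)
      (p⊂q⇒∣p∣<∣q∣ (⊆⊤ , x , ∈⊤ , x∉below)))

    position-mono : ∀ {x y} → key x < key y → toℕ (position x) < toℕ (position y)
    position-mono lt = subst₂ _<_ (sym (toℕ-fromℕ< _)) (sym (toℕ-fromℕ< _)) (below-mono lt)

    position-injective : Injective _≡_ _≡_ position
    position-injective {x} {y} eq with ℕ.<-cmp (key x) (key y)
    ... | tri< lt _ _ = contradiction (cong toℕ eq) (ℕ.<⇒≢ (position-mono lt))
    ... | tri≈ _ eqk _ = key-injective eqk
    ... | tri> _ _ gt = contradiction (cong toℕ (sym eq)) (ℕ.<⇒≢ (position-mono gt))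

  abstract
    sort-by-rank : Σ[ π ∈ Permutation′ n ]
      (∀ {x y} → rank x < rank y → toℕ (π ⟨$⟩ˡ x) < toℕ (π ⟨$⟩ˡ y))
    sort-by-rank with π , π≡ ← injective⇒permutation position position-injective =
      π , λ lt → subst₂ (λ i j → toℕ i < toℕ j) (sym (π≡ _)) (sym (π≡ _)) (position-mono (key-mono lt))

-- Adjacent transpositions and leftmost vertices.

⟨$⟩ˡ-injective : ∀ {n} (π : Permutation′ n) → Injective _≡_ _≡_ (π ⟨$⟩ˡ_)
⟨$⟩ˡ-injective π eq = trans (sym (inverseʳ π)) (trans (cong (π ⟨$⟩ʳ_) eq) (inverseʳ π))

leftmost-unique : ∀ {n} {G : Graph n} (π : Permutation′ n) {A u v} →
                  u ∈ A → v ∈ A → Leftmost {G = G} π A u → Leftmost {G = G} π A v → u ≡ v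
leftmost-unique π u∈A v∈A u-min v-min =
  ⟨$⟩ˡ-injective π (toℕ-injective (ℕ.≤-antisym (u-min v∈A) (v-min u∈A)))

module _ {n} (k l : Fin n) where

  transpose-first : PC.transpose k l k ≡ l
  transpose-first with k ≟ k
  ... | yes _  = refl
  ... | no k≢k = contradiction refl k≢k

  transpose-second : PC.transpose k l l ≡ k
  transpose-second with l ≟ k
  ... | yes l≡k = l≡k
  ... | no _ with l ≟ l
  ...   | yes _  = refl
  ...   | no l≢l = contradiction refl l≢l

  transpose-other : ∀ {x} → x ≢ k → x ≢ l → PC.transpose k l x ≡ x
  transpose-other {x} x≢k x≢l with x ≟ k
  ... | yes x≡k = contradiction x≡k x≢k
  ... | no _ with x ≟ l
  ...   | yes x≡l = contradiction x≡l x≢l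
  ...   | no _    = refl

module _ {n} {G : Graph n} (π σ : Permutation′ n) {k l : Fin n}
         (l≡1+k : toℕ l ≡ suc (toℕ k)) (σ≈ : σ Perm.≈ transpose k l ∘ₚ π) where

  private
    a b : Fin n
    a = π ⟨$⟩ʳ k
    b = π ⟨$⟩ʳ l

    p q : Fin n → ℕ
    p v = toℕ (π ⟨$⟩ˡ v)
    q v = toℕ (σ ⟨$⟩ˡ v)

    -- Passing from entries to positions inverts `transpose k l`, hence the exchanged arguments.
    σˡ≡ : ∀ v → σ ⟨$⟩ˡ v ≡ PC.transpose l k (π ⟨$⟩ˡ v)
    σˡ≡ v = begin
      σ ⟨$⟩ˡ v                                   ≡⟨ PC.transpose-inverse l k ⟨
      lk (PC.transpose k l (σ ⟨$⟩ˡ v))           ≡⟨ cong lk (inverseˡ π) ⟨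
      lk (π ⟨$⟩ˡ (transpose k l ∘ₚ π ⟨$⟩ʳ (σ ⟨$⟩ˡ v)))
        ≡⟨ cong (λ w → lk (π ⟨$⟩ˡ w)) (trans (sym (σ≈ (σ ⟨$⟩ˡ v))) (inverseʳ σ)) ⟩
      lk (π ⟨$⟩ˡ v)                              ∎
      where
      open ≡-Reasoning
      lk = PC.transpose l k

    pa : p a ≡ toℕ k
    pa = cong toℕ (inverseˡ π)

    pb : p b ≡ suc (p a)
    pb = trans (cong toℕ (inverseˡ π)) (trans l≡1+k (cong suc (sym pa)))

    qa : q a ≡ suc (p a)
    qa = trans (cong toℕ (trans (σˡ≡ a)
                 (trans (cong (PC.transpose l k) (inverseˡ π)) (transpose-second l k))))
               (trans l≡1+k (cong suc (sym pa)))

    qb : q b ≡ p a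
    qb = trans (cong toℕ (trans (σˡ≡ b)
                 (trans (cong (PC.transpose l k) (inverseˡ π)) (transpose-first l k))))
               (sym pa)

    q-other : ∀ {x} → x ≢ a → x ≢ b → q x ≡ p x
    q-other {x} x≢a x≢b = cong toℕ (trans (σˡ≡ x) (transpose-other l k (avoid x≢b) (avoid x≢a)))
      where
      avoid : ∀ {m} → x ≢ π ⟨$⟩ʳ m → π ⟨$⟩ˡ x ≢ m
      avoid x≢ refl = x≢ (sym (inverseʳ π))

    p-injective : Injective _≡_ _≡_ p
    p-injective = ⟨$⟩ˡ-injective π ∘ toℕ-injective

  swapped-distinct : b ≢ a
  swapped-distinct b≡a = ℕ.1+n≢n (trans (sym pb) (cong p b≡a))

  -- `b` moves to the old position of `a`, and no vertex of `A` lies before that position, neither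
  -- under `π` nor under `σ`.
  leftmost-swap : ∀ {A} → Leftmost {G = G} π A a → Leftmost {G = G} σ A b
  leftmost-swap a-min {u} u∈A rewrite qb with u ≟ a | u ≟ b
  ... | yes refl | _        rewrite qa = ℕ.n≤1+n _
  ... | no _     | yes refl rewrite qb = ℕ.≤-refl
  ... | no u≢a   | no u≢b   rewrite q-other u≢a u≢b = a-min u∈A

  -- Only the relative order of `a` and `b` changes, so a leftmost vertex can be overtaken only if
  -- it is `a` and `b` lies in `A`.
  leftmost-keep : ∀ {A v} → Leftmost {G = G} π A v → ¬ (v ≡ a × b ∈ A) → Leftmost {G = G} σ A v
  leftmost-keep {v = v} v-min keep {u} u∈A with v ≟ a | v ≟ b
  leftmost-keep {v = v} v-min keep {u} u∈A | yes refl | _ rewrite qa with u ≟ a | u ≟ b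
  ... | yes refl | _        rewrite qa = ℕ.≤-refl
  ... | no _     | yes refl = contradiction (refl , u∈A) keep
  ... | no u≢a   | no u≢b   rewrite q-other u≢a u≢b =
        ℕ.≤∧≢⇒< (v-min u∈A) (u≢a ∘ sym ∘ p-injective)
  leftmost-keep {v = v} v-min keep {u} u∈A | no _ | yes refl rewrite qb with u ≟ a | u ≟ b
  ... | yes refl | _        = contradiction (subst (_≤ p a) pb (v-min u∈A)) ℕ.1+n≰n
  ... | no _     | yes refl rewrite qb = ℕ.≤-refl
  ... | no u≢a   | no u≢b   rewrite q-other u≢a u≢b =
        ℕ.<⇒≤ (subst (_≤ p u) pb (v-min u∈A))
  leftmost-keep {v = v} v-min keep {u} u∈A | no v≢a | no v≢b rewrite q-other v≢a v≢b with u ≟ a | u ≟ b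
  ... | yes refl | _        rewrite qa = ℕ.m≤n⇒m≤1+n (v-min u∈A)
  -- `p v` is at most `p b`, which is `suc (p a)`, and differs from it, so it is at most `p a`.
  ... | no _     | yes refl rewrite qb = s≤s⁻¹
        (subst (p v <_) pb (ℕ.≤∧≢⇒< (v-min u∈A) (v≢b ∘ p-injective)))
  ... | no u≢a   | no u≢b   rewrite q-other u≢a u≢b = v-min u∈A

-- The rank triples the depth d, leaving room to put j last on its level and i first on the next
-- one, so that no vertex is ranked between them.
adjacent-sort : ∀ {n} (d : Fin n → ℕ) {i j} → i ≢ j → d i ≡ suc (d j) →
  Σ[ π ∈ Permutation′ n ] (∀ {x y} → d x < d y → toℕ (π ⟨$⟩ˡ x) < toℕ (π ⟨$⟩ˡ y)) ×
                           toℕ (π ⟨$⟩ˡ i) ≡ suc (toℕ (π ⟨$⟩ˡ j))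
adjacent-sort {n} d {i} {j} i≢j di≡1+dj = π , (π-mono ∘ rank-mono) , adjacent
  where
  tweak : Fin n → ℕ
  tweak x with x ≟ i | x ≟ j
  ... | yes _ | _     = 0
  ... | no _  | yes _ = 2
  ... | no _  | no _  = 1

  tweak<3 : ∀ x → tweak x < 3
  tweak<3 x with x ≟ i | x ≟ j
  ... | yes _ | _     = z<s
  ... | no _  | yes _ = ℕ.≤-refl
  ... | no _  | no _  = s<s z<s

  tweak-i : tweak i ≡ 0
  tweak-i with i ≟ i
  ... | yes _  = refl
  ... | no i≢i = contradiction refl i≢i

  tweak-j : tweak j ≡ 2
  tweak-j with j ≟ i | j ≟ j
  ... | yes j≡i | _      = contradiction (sym j≡i) i≢j
  ... | no _    | yes _  = refl
  ... | no _    | no j≢j = contradiction refl j≢j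

  tweak-other : ∀ {x} → x ≢ i → x ≢ j → tweak x ≡ 1
  tweak-other {x} x≢i x≢j with x ≟ i | x ≟ j
  ... | yes x≡i | _       = contradiction x≡i x≢i
  ... | no _    | yes x≡j = contradiction x≡j x≢j
  ... | no _    | no _    = refl

  rank : Fin n → ℕ
  rank x = tweak x + d x * 3

  rank-mono : ∀ {x y} → d x < d y → rank x < rank y
  rank-mono {x} {y} dx<dy = begin-strict
    tweak x + d x * 3  <⟨ ℕ.+-monoˡ-< (d x * 3) (tweak<3 x) ⟩
    suc (d x) * 3      ≤⟨ ℕ.*-monoˡ-≤ 3 dx<dy ⟩
    d y * 3            ≤⟨ ℕ.m≤n+m _ _ ⟩
    rank y             ∎
    where open ℕ.≤-Reasoning

  rank-i : rank i ≡ 3 + d j * 3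
  rank-i = trans (cong (_+ d i * 3) tweak-i) (cong (_* 3) di≡1+dj)

  rank-j : rank j ≡ 2 + d j * 3
  rank-j = cong (_+ d j * 3) tweak-j

  rank-other : ∀ {x} → x ≢ i → x ≢ j → rank x ≡ 1 + d x * 3
  rank-other {x} x≢i x≢j = cong (_+ d x * 3) (tweak-other x≢i x≢j)

  sorted = sort-by-rank rank
  π = proj₁ sorted

  π-mono : ∀ {x y} → rank x < rank y → toℕ (π ⟨$⟩ˡ x) < toℕ (π ⟨$⟩ˡ y)
  π-mono = proj₂ sorted

  -- `j` and `i` have the consecutive ranks `2 + d j * 3` and `3 + d j * 3`, while any other `y` has
  -- rank 1 modulo 3: it is sorted before `j` if `d y` is at most `d j`, and after `i` otherwise.
  no-between : ∀ y → toℕ (π ⟨$⟩ˡ j) < toℕ (π ⟨$⟩ˡ y) → ¬ toℕ (π ⟨$⟩ˡ y) < toℕ (π ⟨$⟩ˡ i)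
  no-between y j<y y<i with d y ℕ.≤? d j
  ... | yes dy≤dj = ℕ.<-asym j<y (π-mono (subst₂ _<_ (sym rank-y) (sym rank-j)
                      (s<s (s≤s (ℕ.*-monoˡ-≤ 3 dy≤dj)))))
    where rank-y = rank-other (λ { refl → ℕ.<-irrefl refl y<i }) (λ { refl → ℕ.<-irrefl refl j<y })
  ... | no dy≰dj = ℕ.<-asym y<i (π-mono (subst₂ _<_ (sym rank-i) (sym rank-y)
                     (s<s (ℕ.*-monoˡ-≤ 3 (ℕ.≰⇒> dy≰dj)))))
    where rank-y = rank-other (λ { refl → ℕ.<-irrefl refl y<i }) (λ { refl → ℕ.<-irrefl refl j<y })

  adjacent : toℕ (π ⟨$⟩ˡ i) ≡ suc (toℕ (π ⟨$⟩ˡ j))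
  adjacent with ℕ.m≤n⇒m<n∨m≡n (π-mono (rank-mono (ℕ.≤-reflexive (sym di≡1+dj))))
  ... | inj₂ eq = sym eq
  -- With a larger gap, the entry right after `j` would lie strictly between.
  ... | inj₁ lt = ⊥-elim (no-between y (ℕ.≤-reflexive (sym y-position))
                    (subst (_< toℕ (π ⟨$⟩ˡ i)) (sym y-position) lt))
    where
    m<n = ℕ.<-trans lt (toℕ<n (π ⟨$⟩ˡ i))
    y = π ⟨$⟩ʳ fromℕ< m<n
    y-position : toℕ (π ⟨$⟩ˡ y) ≡ suc (toℕ (π ⟨$⟩ˡ j))
    y-position = trans (cong toℕ (inverseˡ π)) (toℕ-fromℕ< m<n)

-- Connected sets and components.

module _ {n} (G : Graph n) where

  walk-mono : ∀ {U V x y} → U ⊆ V → Star (InducedAdj G U) x y → Star (InducedAdj G V) x y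
  walk-mono U⊆V = Star.map λ (x∈ , y∈ , a) → U⊆V x∈ , U⊆V y∈ , a

  walk-sym : ∀ {U x y} → Star (InducedAdj G U) x y → Star (InducedAdj G U) y x
  walk-sym = reverse λ (x∈ , y∈ , a) → y∈ , x∈ , symm G a

  connected-⁅⁆ : ∀ x → Connected G ⁅ x ⁆
  connected-⁅⁆ x y∈ z∈ with refl ← x∈⁅y⁆⇒x≡y x y∈ | refl ← x∈⁅y⁆⇒x≡y x z∈ = ε

  -- Every vertex is reached from `x`, those of `B` by way of `y`. The walk is empty for sets that
  -- share a vertex, and a single step when a set grows by a neighbour.
  connected-∪ : ∀ {A B x y} → Connected G A → Connected G B → x ∈ A → y ∈ B →
                Star (InducedAdj G (A ∪ B)) x y → Connected G (A ∪ B)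
  connected-∪ {A} {B} {x} {y} cA cB x∈A y∈B xy {u} {v} u∈ v∈ = walk-sym (from-x u∈) ◅◅ from-x v∈
    where
    from-x : ∀ {w} → w ∈ A ∪ B → Star (InducedAdj G (A ∪ B)) x w
    from-x w∈ with x∈p∪q⁻ A B w∈
    ... | inj₁ w∈A = walk-mono (p⊆p∪q B) (cA x∈A w∈A)
    ... | inj₂ w∈B = xy ◅◅ walk-mono (q⊆p∪q A B) (cB y∈B w∈B)

  module _ {U : Subset n} {x : Fin n} where

    Boundary : Subset n → Fin n → Fin n → Set
    Boundary S y z = y ∈ S × z ∈ U × z ∉ S × Adj G y z

    boundary? : ∀ S → Dec (∃[ y ] ∃[ z ] Boundary S y z)
    boundary? S = any? λ y → any? λ z →
      (y ∈? S) ×-dec (z ∈? U) ×-dec ¬? (z ∈? S) ×-dec adj? G y z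

    -- A walk in `L` that starts in `S` cannot leave `S`: its first step outside would be a boundary
    -- edge.
    closed-maximal : ∀ {S L} → ¬ (∃[ y ] ∃[ z ] Boundary S y z) →
                     x ∈ S → S ⊆ L → L ⊆ U → Connected G L → L ⊆ S
    closed-maximal {S} {L} closed x∈S S⊆L L⊆U cL z∈L = stay x∈S (cL (S⊆L x∈S) z∈L)
      where
      stay : ∀ {y z} → y ∈ S → Star (InducedAdj G L) y z → z ∈ S
      stay y∈S ε = y∈S
      stay {y} y∈S (_◅_ {j = z} (_ , z∈L , yz) w) with z ∈? S
      ... | yes z∈S = stay z∈S w
      ... | no  z∉S = contradiction (y , z , y∈S , L⊆U z∈L , z∉S , yz) closed

    -- Boundary vertices are added one at a time. Strict growth inside a finite set terminates, and
    -- a set without boundary is maximal.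
    grow : ∀ S → Acc _⊃_ S → x ∈ S → S ⊆ U → Connected G S →
           ∃[ K ] (x ∈ K × IsComponent G U K)
    grow S (acc rs) x∈S S⊆U cS with boundary? S
    ... | no closed = S , x∈S , (λ {_} → S⊆U) , ((x , x∈S) , λ {_} {_} → cS) ,
            λ L L⊆U (_ , cL) S⊆L → closed-maximal closed x∈S S⊆L L⊆U cL
    ... | yes (y , z , y∈S , z∈U , z∉S , yz) =
            grow (S ∪ ⁅ z ⁆) (rs (S⊆ , z , z∈ , z∉S)) (S⊆ x∈S) ⊆U
              (connected-∪ cS (connected-⁅⁆ z) y∈S (x∈⁅x⁆ z) (return (S⊆ y∈S , z∈ , yz)))
      where
      S⊆ : S ⊆ S ∪ ⁅ z ⁆
      S⊆ = p⊆p∪q ⁅ z ⁆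

      z∈ : z ∈ S ∪ ⁅ z ⁆
      z∈ = q⊆p∪q S ⁅ z ⁆ (x∈⁅x⁆ z)

      ⊆U : S ∪ ⁅ z ⁆ ⊆ U
      ⊆U w∈ with x∈p∪q⁻ S ⁅ z ⁆ w∈
      ... | inj₁ w∈S = S⊆U w∈S
      ... | inj₂ w∈z with refl ← x∈⁅y⁆⇒x≡y z w∈z = z∈U

  component-of : ∀ {U x} → x ∈ U → ∃[ K ] (x ∈ K × IsComponent G U K)
  component-of {U} {x} x∈U = grow ⁅ x ⁆ (⊃-wellFounded _) (x∈⁅x⁆ x) ⁅x⁆⊆U (connected-⁅⁆ x)
    where
    ⁅x⁆⊆U : ⁅ x ⁆ ⊆ U
    ⁅x⁆⊆U y∈ with refl ← x∈⁅y⁆⇒x≡y x y∈ = x∈U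

  -- The membership proof is irrelevant, so that functions descending along
  -- `locate` do not depend on it.
  abstract
    locate : ∀ U x → .(x ∈ U) → Component G U
    locate U x x∈U with K , _ , c ← component-of (recompute (x ∈? U) x∈U) = K , [ c ]

    ∈-locate : ∀ {U x} .(x∈U : x ∈ U) → x ∈ value (locate U x x∈U)
    ∈-locate {U} {x} x∈U with _ , x∈K , _ ← component-of (recompute (x ∈? U) x∈U) = x∈K

  -- The proof carried by an edge is irrelevant, but nonemptiness is decidable, so a vertex is
  -- recomputed from the set alone.
  edge-nonempty : (A : Edge (𝓑 G)) → Nonempty (value A)
  edge-nonempty (A , [ A∈𝓑 ]) = recompute (nonempty? A) (proj₁ A∈𝓑)

  module _ {U : Subset n} where

    ⌊_⌋ : Component G U → Edge (𝓑 G)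
    ⌊ K , [ c ] ⌋ = K , [ proj₁ (proj₂ c) ]

    component-⊆ : (K : Component G U) → value K ⊆ U
    component-⊆ (K , [ c ]) x∈K = recompute (_ ∈? U) (proj₁ c x∈K)

    -- Sharing `x`, the two sets have a connected union, which the maximality of `K` absorbs.
    -- Membership is decidable, so the irrelevant proofs may be used.
    edge-⊆-component : ∀ {x} (A : Edge (𝓑 G)) (K : Component G U) → value A ⊆ U →
                       x ∈ value A → x ∈ value K → value A ⊆ value K
    edge-⊆-component (A , [ a ]) (K , [ c ]) A⊆U x∈A x∈K y∈A =
      recompute (_ ∈? K) (absorb a c (q⊆p∪q K A y∈A))
      where
      absorb : 𝓑 G A → IsComponent G U K → K ∪ A ⊆ K
      absorb (_ , cA) (K⊆U , (_ , cK) , maximal) =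
        maximal (K ∪ A) ∪⊆U ((_ , p⊆p∪q A x∈K) , connected-∪ cK cA x∈K x∈A ε) (p⊆p∪q A)
        where
        ∪⊆U : K ∪ A ⊆ U
        ∪⊆U z∈ with x∈p∪q⁻ K A z∈
        ... | inj₁ z∈K = K⊆U z∈K
        ... | inj₂ z∈A = A⊆U z∈A

    component-unique : ∀ {x} (K L : Component G U) → x ∈ value K → x ∈ value L → K ≡ L
    component-unique K L x∈K x∈L = value-injective (⊆-antisym
      (edge-⊆-component ⌊ K ⌋ L (component-⊆ K) x∈K x∈L)
      (edge-⊆-component ⌊ L ⌋ K (component-⊆ L) x∈L x∈K))

  cover : ∀ U (A : Edge (𝓑 G)) → .(value A ⊆ U) → Component G U
  cover U A A⊆U = locate U (proj₁ (edge-nonempty A)) (A⊆U (proj₂ (edge-nonempty A)))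

  abstract
    ⊆-cover : ∀ {U} (A : Edge (𝓑 G)) .(A⊆U : value A ⊆ U) → value A ⊆ value (cover U A A⊆U)
    ⊆-cover {U} A A⊆U = edge-⊆-component A (cover U A A⊆U) (recompute (value A ⊆? U) A⊆U)
      (proj₂ (edge-nonempty A)) (∈-locate (A⊆U (proj₂ (edge-nonempty A))))

  -- Heads and depths read off a forest.

  -- Covers both an elimination forest, with `U` equal to `⊤`, and the subtrees of a root `v`, with
  -- `U` equal to `C - v`.
  Forest : Subset n → Set
  Forest U = (K : Component G U) → ElimTree G (value K)

  mutual
    headT : ∀ {C} → ElimTree G C → (A : Edge (𝓑 G)) → .(value A ⊆ C) → Fin n
    headT (node v _ ts) A A⊆C with v ∈? value A
    ... | yes _  = v
    ... | no v∉A = headF ts A (⊆-minus A⊆C v∉A)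

    headF : ∀ {U} → Forest U → (A : Edge (𝓑 G)) → .(value A ⊆ U) → Fin n
    headF {U} ts A A⊆U = headT (ts (cover U A A⊆U)) A (⊆-cover A A⊆U)

  mutual
    depthT : ∀ {C} → ElimTree G C → (x : Fin n) → .(x ∈ C) → ℕ
    depthT (node v _ ts) x x∈C with x ≟ v
    ... | yes _  = 0
    ... | no x≢v = suc (depthF ts x (x∈p∧x≢y⇒x∈p-y x∈C x≢v))

    depthF : ∀ {U} → Forest U → (x : Fin n) → .(x ∈ U) → ℕ
    depthF {U} ts x x∈U = depthT (ts (locate U x x∈U)) x (∈-locate _)

  module _ {U} (ts : Forest U) where

    -- Components that share a vertex coincide, so `K` is the one that `cover` selects.
    headF-component : ∀ A (K : Component G U) .(A⊆U : value A ⊆ U) (A⊆K : value A ⊆ value K) →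
                      headF ts A A⊆U ≡ headT (ts K) A A⊆K
    headF-component A K A⊆U A⊆K
      with refl ← component-unique K (cover U A A⊆U)
                    (A⊆K (proj₂ (edge-nonempty A))) (⊆-cover A A⊆U (proj₂ (edge-nonempty A))) = refl

    depthF-component : ∀ x (K : Component G U) .(x∈U : x ∈ U) (x∈K : x ∈ value K) →
                       depthF ts x x∈U ≡ depthT (ts K) x x∈K
    depthF-component x K x∈U x∈K
      with refl ← component-unique K (locate U x x∈U) x∈K (∈-locate _) = refl

  mutual
    headT-∈ : ∀ {C} (t : ElimTree G C) A .(A⊆C : value A ⊆ C) → headT t A A⊆C ∈ value A
    headT-∈ (node v _ ts) A A⊆C with v ∈? value A
    ... | yes v∈A = v∈A
    ... | no v∉A  = headF-∈ ts A (⊆-minus A⊆C v∉A)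

    headF-∈ : ∀ {U} (ts : Forest U) A .(A⊆U : value A ⊆ U) → headF ts A A⊆U ∈ value A
    headF-∈ {U} ts A A⊆U = headT-∈ (ts (cover U A A⊆U)) A (⊆-cover A A⊆U)

  mutual
    -- The edge `A` stays inside one component until its head is removed; its other vertices then
    -- lie strictly below that root.
    head-minimises-depthT : ∀ {C} (t : ElimTree G C) A (A⊆C : value A ⊆ C) {x} (x∈A : x ∈ value A) →
      x ≢ headT t A A⊆C →
      depthT t (headT t A A⊆C) (A⊆C (headT-∈ t A A⊆C)) < depthT t x (A⊆C x∈A)
    head-minimises-depthT (node v v∈ ts) A A⊆C {x} x∈A x≢h with v ∈? value A
    head-minimises-depthT (node v v∈ ts) A A⊆C {x} x∈A x≢h | yes v∈A with v ≟ v | x ≟ v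
    ... | no v≢v | _      = contradiction refl v≢v
    ... | yes _  | yes eq = contradiction eq x≢h
    ... | yes _  | no _   = z<s
    head-minimises-depthT (node v v∈ ts) A A⊆C {x} x∈A x≢h | no v∉A
      with headF ts A (⊆-minus A⊆C v∉A) ≟ v | x ≟ v
    ... | yes eq | _          = contradiction (subst (_∈ value A) eq (headF-∈ ts A (⊆-minus A⊆C v∉A))) v∉A
    ... | no _     | yes refl = contradiction x∈A v∉A
    ... | no _     | no _     = s<s (head-minimises-depthF ts A (⊆-minus A⊆C v∉A) x∈A x≢h)

    head-minimises-depthF : ∀ {U} (ts : Forest U) A (A⊆U : value A ⊆ U) {x} (x∈A : x ∈ value A) →
      x ≢ headF ts A A⊆U →
      depthF ts (headF ts A A⊆U) (A⊆U (headF-∈ ts A A⊆U)) < depthF ts x (A⊆U x∈A)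
    head-minimises-depthF {U} ts A A⊆U {x} x∈A x≢h =
      subst₂ _<_ (sym (depthF-component ts _ K (A⊆U h∈A) (A⊆K h∈A)))
        (sym (depthF-component ts x K (A⊆U x∈A) (A⊆K x∈A)))
        (head-minimises-depthT (ts K) A A⊆K x∈A x≢h)
      where
      h∈A = headF-∈ ts A A⊆U
      K = cover U A A⊆U
      A⊆K : value A ⊆ value K
      A⊆K = ⊆-cover A A⊆U

  -- From forests to acyclic orientations.

  orientation : ElimForest G → Orientation (𝓑 G)
  orientation F .head  A = headF F A ⊆⊤
  orientation F .head∈ A = headF-∈ F A ⊆⊤

  depth : ElimForest G → Fin n → ℕ
  depth F x = depthF F x ∈⊤

  arc-depth : ∀ F {x y} → Arc (orientation F) x y → depth F y < depth F x
  arc-depth F (x≢h , A , x∈A , _ , refl) = head-minimises-depthF F A ⊆⊤ x∈A x≢h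

  orientation-acyclic : ∀ F → Acyclic (orientation F)
  orientation-acyclic F = ℕ.<-irrefl refl ∘ decreases
    where
    decreases : ∀ {x y} → TransClosure (Arc (orientation F)) x y → depth F y < depth F x
    decreases [ a ]    = arc-depth F a
    decreases (a ∷ as) = ℕ.<-trans (decreases as) (arc-depth F a)

  -- From orientations to forests.

  mutual
    -- The recursion of `treeOf` as a relation, so that later arguments are inductions on trees and
    -- need not unfold the well-founded recursion.
    FollowsT : Orientation (𝓑 G) → (C : Edge (𝓑 G)) → ElimTree G (value C) → Set
    FollowsT h C (node v _ ts) = v ≡ head h C × FollowsF h ts

    FollowsF : Orientation (𝓑 G) → ∀ {U} → Forest U → Set
    FollowsF h ts = ∀ K → FollowsT h ⌊ K ⌋ (ts K)

  component-⊂ : ∀ {C v} → v ∈ C → (K : Component G (C - v)) → value K ⊂ C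
  component-⊂ v∈C K = ⊆-⊂-trans (component-⊆ K) (x∈p⇒p-x⊂p v∈C)

  treeOf : Orientation (𝓑 G) → (C : Edge (𝓑 G)) → Acc _⊂_ (value C) → ElimTree G (value C)
  treeOf h C (acc rs) = node (head h C) (head∈ h C) λ K →
    treeOf h ⌊ K ⌋ (rs (component-⊂ (head∈ h C) K))

  treeOf-follows : ∀ h C ac → FollowsT h C (treeOf h C ac)
  treeOf-follows h C (acc rs) = refl , λ K → treeOf-follows h ⌊ K ⌋ (rs (component-⊂ (head∈ h C) K))

  abstract
    forest : Orientation (𝓑 G) → ElimForest G
    forest h K = treeOf h ⌊ K ⌋ (⊂-wellFounded _)

    forest-follows : ∀ h → FollowsF h (forest h)
    forest-follows h K = treeOf-follows h ⌊ K ⌋ (⊂-wellFounded (value K))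

  follows-unique : ∀ {h h′} → h ≈ᵒ h′ → ∀ C {t t′} → FollowsT h C t → FollowsT h′ C t′ → t ≈ᵗ t′
  follows-unique h≈h′ C {node _ _ _} {node _ _ _} (eq , fs) (eq′ , fs′)
    with refl ← trans eq (trans (h≈h′ C) (sym eq′)) =
    node λ K → follows-unique h≈h′ ⌊ K ⌋ (fs K) (fs′ K)

  follows-resp : ∀ {h} C {t t′} → t ≈ᵗ t′ → FollowsT h C t → FollowsT h C t′
  follows-resp C (node eqs) (eq , fs) = eq , λ K → follows-resp ⌊ K ⌋ (eqs K) (fs K)

  -- The correspondence between forests and acyclic orientations.

  module _ {h : Orientation (𝓑 G)} where

    mutual
      -- `C` is itself an edge, and the head read off for it is the root. Edges inside `C - v` avoid
      -- the root, so agreement passes to the subtrees.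
      agrees⇒followsT : ∀ C t → (∀ A (A⊆C : value A ⊆ value C) → head h A ≡ headT t A A⊆C) → FollowsT h C t
      agrees⇒followsT C (node v v∈C ts) agree = trans root (sym (agree C ⊆-refl)) , agrees⇒followsF ts agree′
        where
        root : v ≡ headT (node v v∈C ts) C ⊆-refl
        root with v ∈? value C
        ... | yes _  = refl
        ... | no v∉C = contradiction v∈C v∉C

        agree′ : ∀ A (A⊆ : value A ⊆ value C - v) → head h A ≡ headF ts A A⊆
        agree′ A A⊆ with v ∈? value A | agree A (∈-minus⇒∈ ∘ A⊆)
        ... | yes v∈A | _  = contradiction refl (∈-minus⇒≢ (A⊆ v∈A))
        ... | no _    | eq = eq

      agrees⇒followsF : ∀ {U} (ts : Forest U) →
        (∀ A (A⊆U : value A ⊆ U) → head h A ≡ headF ts A A⊆U) → FollowsF h ts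
      agrees⇒followsF ts agree K = agrees⇒followsT ⌊ K ⌋ (ts K) λ A A⊆K →
        trans (agree A (component-⊆ K ∘ A⊆K)) (headF-component ts A K (component-⊆ K ∘ A⊆K) A⊆K)

    mutual
      -- If the root lies in `A`, it is the head of the larger edge `C`, and heredity makes it the
      -- head of `A`; otherwise `A` lies in one subtree.
      follows⇒agreesT : Hereditary h → ∀ C t → FollowsT h C t → ∀ A (A⊆C : value A ⊆ value C) →
                        headT t A A⊆C ≡ head h A
      follows⇒agreesT hered C (node v _ ts) (refl , fs) A A⊆C with v ∈? value A
      ... | yes v∈A = sym (hered A C A⊆C v∈A)
      ... | no v∉A  = follows⇒agreesF hered ts fs A (⊆-minus A⊆C v∉A)

      follows⇒agreesF : Hereditary h → ∀ {U} (ts : Forest U) → FollowsF h ts → ∀ A (A⊆U : value A ⊆ U) →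
                        headF ts A A⊆U ≡ head h A
      follows⇒agreesF hered {U} ts fs A A⊆U = follows⇒agreesT hered ⌊ K ⌋ (ts K) (fs K) A
        (⊆-cover A A⊆U)
        where K = cover U A A⊆U

  orientation-follows : ∀ F → FollowsF (orientation F) F
  orientation-follows F = agrees⇒followsF F λ A A⊆⊤ → refl

  -- The second forest `F′` makes the congruence of `orientation` and an inverse law of the
  -- bijection instances of one statement.
  orientation-unique : ∀ {h F F′} → Hereditary h → FollowsF h F′ → F ≈ᶠ F′ → orientation F ≈ᵒ h
  orientation-unique {F = F} hered fs F≈F′ A = follows⇒agreesF hered F
    (λ K → follows-resp ⌊ K ⌋ (≈ᵗ-sym (F≈F′ K)) (fs K)) A ⊆⊤

  forest-orientation : ∀ F {h} → h ≈ᵒ orientation F → forest h ≈ᶠ F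
  forest-orientation F {h} h≈ K =
    follows-unique h≈ ⌊ K ⌋ (forest-follows h K) (orientation-follows F K)

  forest-cong : ∀ {h h′} → h ≈ᵒ h′ → forest h ≈ᶠ forest h′
  forest-cong {h} {h′} h≈h′ K =
    follows-unique h≈h′ ⌊ K ⌋ (forest-follows h K) (forest-follows h′ K)

  orientation-cong : ∀ {F F′} → F ≈ᶠ F′ → orientation F ≈ᵒ orientation F′
  orientation-cong {F′ = F′} = orientation-unique
    (acyclic⇒hereditary (orientation F′) (orientation-acyclic F′)) (orientation-follows F′)

  bijection : Inverse (acyclicOrientations (𝓑 G)) (eliminationForests G)
  bijection = record
    { to        = λ (h , _) → forest h
    ; from      = λ F → orientation F , orientation-acyclic F
    ; to-cong   = forest-cong
    ; from-cong = orientation-cong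
    ; inverse   = (λ {F} h≈ → forest-orientation F h≈)
                , λ {(h , ac)} F≈ → orientation-unique (acyclic⇒hereditary h ac) (forest-follows h) F≈
    }

  module _ {h : Orientation (𝓑 G)} (ac : Acyclic h) where

    orientation-forest : orientation (forest h) ≈ᵒ h
    orientation-forest = orientation-unique (acyclic⇒hereditary h ac) (forest-follows h)
      (λ K → ≈ᵗ-refl (forest h K))

    head-minimises-depth : ∀ A {x} → x ∈ value A → x ≢ head h A →
                           depth (forest h) (head h A) < depth (forest h) x
    head-minimises-depth A x∈A x≢h = arc-depth (forest h)
      (x≢h , A , x∈A , head∈ h A , sym (orientation-forest A))

  -- Permutations that produce a forest.

  Sorts : Permutation′ n → Orientation (𝓑 G) → Set
  Sorts π h = ∀ A → Leftmost {G = G} π (value A) (head h A)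

  module _ {π : Permutation′ n} where

    follows⇒producesT : ∀ {h} → Sorts π h → ∀ C t → FollowsT h C t → ProducesTree π t
    follows⇒producesT sorts C (node v v∈ ts) (refl , fs) =
      node (sorts C) λ K → follows⇒producesT sorts ⌊ K ⌋ (ts K) (fs K)

    sorts⇒produces : ∀ {h} → Sorts π h → Produces π (forest h)
    sorts⇒produces {h} sorts K = follows⇒producesT sorts ⌊ K ⌋ (forest h K) (forest-follows h K)

    mutual
      -- The root is leftmost in all of `C`, hence in every edge of `C` that contains it; any other
      -- edge lies in one subtree.
      producesT⇒leftmost : ∀ {C} (t : ElimTree G C) → ProducesTree π t → ∀ A (A⊆C : value A ⊆ C) →
                           Leftmost {G = G} π (value A) (headT t A A⊆C)
      producesT⇒leftmost (node v _ ts) (node v-min ps) A A⊆C u∈A with v ∈? value A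
      ... | yes _  = v-min (A⊆C u∈A)
      ... | no v∉A = producesF⇒leftmost ts ps A (⊆-minus A⊆C v∉A) u∈A

      producesF⇒leftmost : ∀ {U} (ts : Forest U) → (∀ K → ProducesTree π (ts K)) →
                           ∀ A (A⊆U : value A ⊆ U) → Leftmost {G = G} π (value A) (headF ts A A⊆U)
      producesF⇒leftmost {U} ts ps A A⊆U = producesT⇒leftmost (ts K) (ps K) A (⊆-cover A A⊆U)
        where K = cover U A A⊆U

    produces⇒sorts : ∀ {h} → Acyclic h → Produces π (forest h) → Sorts π h
    produces⇒sorts {h} ac ps A =
      subst (Leftmost {G = G} π (value A)) (orientation-forest ac A)
        (producesF⇒leftmost (forest h) ps A ⊆⊤)

  -- Rotations are pair flips.

  rotation⇒flip : ∀ {h h′} → Acyclic h → Acyclic h′ → RotationGraph G (forest h) (forest h′) →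
                  ∃[ i ] ∃[ j ] PairFlip i j h h′
  rotation⇒flip {h} {h′} ac ac′ (F≉F′ , π , σ , πF , σF′ , k , l , l≡1+k , σ≈) =
    -- The later of the two exchanged entries becomes the new head, so it comes first in the pair.
    π ⟨$⟩ʳ l , π ⟨$⟩ʳ k , record
      { distinct = swapped-distinct {G = G} π σ l≡1+k σ≈
      ; flipped  = λ A (hA≡a , b∈A) → leftmost-unique {G = G} σ (head∈ h′ A) b∈A (σ-sorts A)
          (leftmost-swap {G = G} π σ l≡1+k σ≈ (subst (Leftmost {G = G} π (value A)) hA≡a (π-sorts A)))
      ; kept     = λ A keep → leftmost-unique {G = G} σ (head∈ h′ A) (head∈ h A) (σ-sorts A)
          (leftmost-keep {G = G} π σ l≡1+k σ≈ (π-sorts A) keep)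
      ; changed  = λ h′≈h → F≉F′ (forest-cong (λ A → sym (h′≈h A)))
      }
    where
    π-sorts = produces⇒sorts ac πF
    σ-sorts = produces⇒sorts ac′ σF′

  -- Pair flips are rotations.

  depth-root : ∀ {h x} C t → FollowsT h C t → head h C ≡ x → .(x∈C : x ∈ value C) → depthT t x x∈C ≡ 0
  depth-root {h} C (node v _ ts) (refl , _) refl _ with v ≟ v
  ... | yes _  = refl
  ... | no v≢v = contradiction refl v≢v

  module _ {h h′ : Orientation (𝓑 G)} (hered : Hereditary h) (hered′ : Hereditary h′)
           {i j : Fin n} (flip : PairFlip i j h h′) where

    open PairFlip flip

    -- The flip turns the head of C from j into i.  By heredity of h′ the component of C - j
    -- containing i then has head i under h′, and hence under h, as it does not contain j.
    child-head : ∀ C → head h C ≡ j → i ∈ value C → (K : Component G (value C - j)) → i ∈ value K →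
                 head h ⌊ K ⌋ ≡ i
    child-head C hC≡j i∈C K i∈K = begin
      head h ⌊ K ⌋   ≡⟨ kept ⌊ K ⌋ (λ (hK≡j , _) → ∈-minus⇒≢ (component-⊆ K (head∈ h ⌊ K ⌋)) hK≡j) ⟨
      head h′ ⌊ K ⌋  ≡⟨ hered′ ⌊ K ⌋ C (∈-minus⇒∈ ∘ component-⊆ K) (subst (_∈ value K) (sym h′C≡i) i∈K) ⟩
      head h′ C      ≡⟨ h′C≡i ⟩
      i              ∎
      where
      open ≡-Reasoning
      h′C≡i = flipped C (hC≡j , i∈C)

    mutual
      -- The descent towards `A` reaches `j` as a root; by `child-head`, `i` is then the root of its
      -- component, one level deeper.
      flip-depthT : ∀ C t → FollowsT h C t → ∀ A (A⊆C : value A ⊆ value C) → head h A ≡ j →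
                    (j∈A : j ∈ value A) (i∈A : i ∈ value A) →
                    depthT t i (A⊆C i∈A) ≡ suc (depthT t j (A⊆C j∈A))
      flip-depthT C (node v v∈ ts) (refl , fs) A A⊆C hA≡j j∈A i∈A with v ∈? value A
      flip-depthT C (node v v∈ ts) (refl , fs) A A⊆C hA≡j j∈A i∈A | yes v∈A
        -- By heredity the root is the head of `A`, which is `j`.
        with refl ← trans (sym (hered A C A⊆C v∈A)) hA≡j | i ≟ v | v ≟ v
      ... | yes i≡j | _      = contradiction i≡j distinct
      ... | no _    | no v≢v = contradiction refl v≢v
      ... | no i≢j  | yes _  = cong suc
            (depth-root ⌊ K ⌋ (ts K) (fs K) (child-head C refl (A⊆C i∈A) K (∈-locate i∈C-j)) (∈-locate i∈C-j))
        where
        i∈C-j : i ∈ value C - v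
        i∈C-j = x∈p∧x≢y⇒x∈p-y (A⊆C i∈A) i≢j
        K = locate (value C - v) i i∈C-j
      flip-depthT C (node v v∈ ts) (refl , fs) A A⊆C hA≡j j∈A i∈A | no v∉A with i ≟ v | j ≟ v
      ... | yes refl | _        = contradiction i∈A v∉A
      ... | no _     | yes refl = contradiction j∈A v∉A
      ... | no _     | no _     = cong suc (flip-depthF ts fs A (⊆-minus A⊆C v∉A) hA≡j j∈A i∈A)

      flip-depthF : ∀ {U} (ts : Forest U) → FollowsF h ts → ∀ A (A⊆U : value A ⊆ U) → head h A ≡ j →
                    (j∈A : j ∈ value A) (i∈A : i ∈ value A) →
                    depthF ts i (A⊆U i∈A) ≡ suc (depthF ts j (A⊆U j∈A))
      flip-depthF {U} ts fs A A⊆U hA≡j j∈A i∈A = begin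
        depthF ts i _             ≡⟨ depthF-component ts i K (A⊆U i∈A) (A⊆K i∈A) ⟩
        depthT (ts K) i _         ≡⟨ flip-depthT ⌊ K ⌋ (ts K) (fs K) A A⊆K hA≡j j∈A i∈A ⟩
        suc (depthT (ts K) j _)   ≡⟨ cong suc (depthF-component ts j K (A⊆U j∈A) (A⊆K j∈A)) ⟨
        suc (depthF ts j _)       ∎
        where
        open ≡-Reasoning
        K = cover U A A⊆U
        A⊆K : value A ⊆ value K
        A⊆K = ⊆-cover A A⊆U

  -- `changed` names no edge that changes, but the equation is decidable, so a contradiction
  -- suffices: were it false, no edge with head `j` would contain `i`, and the flip would change
  -- nothing.
  flip-depth : ∀ {h h′ i j} → Acyclic h → Acyclic h′ → PairFlip i j h h′ →
               depth (forest h) i ≡ suc (depth (forest h) j)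
  flip-depth {h} {h′} {i} {j} ac ac′ flip
    with depth (forest h) i ℕ.≟ suc (depth (forest h) j)
  ... | yes eq = eq
  ... | no neq = contradiction
    (λ A → kept A λ (hA≡j , i∈A) → neq
      (flip-depthF (acyclic⇒hereditary h ac) (acyclic⇒hereditary h′ ac′) flip
        (forest h) (forest-follows h) A ⊆⊤ hA≡j (subst (_∈ value A) hA≡j (head∈ h A)) i∈A))
    changed
    where open PairFlip flip

  flip⇒rotation : ∀ {h h′ i j} → Acyclic h → Acyclic h′ → PairFlip i j h h′ →
                  RotationGraph G (forest h) (forest h′)
  flip⇒rotation {h} {h′} {i} {j} ac ac′ flip
    with π , mono , adjacent ← adjacent-sort (depth (forest h)) (PairFlip.distinct flip)
                                 (flip-depth ac ac′ flip) =
    F≉F′ , π , σ , sorts⇒produces π-sorts , sorts⇒produces σ-sorts ,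
    π ⟨$⟩ˡ j , π ⟨$⟩ˡ i , adjacent , λ _ → refl
    where
    open PairFlip flip

    σ = transpose (π ⟨$⟩ˡ j) (π ⟨$⟩ˡ i) ∘ₚ π

    F≉F′ : ¬ (forest h ≈ᶠ forest h′)
    F≉F′ F≈F′ = changed λ A → begin
      head h′ A                         ≡⟨ orientation-forest ac′ A ⟨
      head (orientation (forest h′)) A  ≡⟨ orientation-cong F≈F′ A ⟨
      head (orientation (forest h)) A   ≡⟨ orientation-forest ac A ⟩
      head h A                          ∎
      where open ≡-Reasoning

    π-sorts : Sorts π h
    π-sorts A {u} u∈A with u ≟ head h A
    ... | yes refl = ℕ.≤-refl
    ... | no u≢h   = ℕ.<⇒≤ (mono (head-minimises-depth ac A u∈A u≢h))

    σ-sorts : Sorts σ h′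
    σ-sorts A with (head h A ≟ j) ×-dec (i ∈? value A)
    ... | yes (hA≡j , i∈A) =
          -- `leftmost-swap` speaks of the entries at the positions of `j` and `i`; `inverseʳ` turns
          -- them back into `j` and `i`.
          subst (Leftmost {G = G} σ (value A)) (trans (inverseʳ π) (sym (flipped A (hA≡j , i∈A))))
            (leftmost-swap {G = G} π σ adjacent (λ _ → refl)
              (subst (Leftmost {G = G} π (value A)) (trans hA≡j (sym (inverseʳ π))) (π-sorts A)))
    ... | no keep =
          subst (Leftmost {G = G} σ (value A)) (sym (kept A keep))
            (leftmost-keep {G = G} π σ adjacent (λ _ → refl) (π-sorts A)
              λ (hA≡ , i∈A) → keep (trans hA≡ (inverseʳ π) , subst (_∈ value A) (inverseʳ π) i∈A))

lemma19 : (n : ℕ) (G : Graph n) →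
    Σ[ φ ∈ Inverse (acyclicOrientations (𝓑 G)) (eliminationForests G) ]
    (∀ (h h′ : AcyclicOrientation (𝓑 G)) →
    FlipGraph (𝓑 G) h h′ ⇔ RotationGraph G (Inverse.to φ h) (Inverse.to φ h′))
lemma19 n G = bijection G , λ (h , ac) (h′ , ac′) →
  mk⇔ (λ (i , j , flip) → flip⇒rotation G ac ac′ flip) (rotation⇒flip G ac ac′)
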